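{- Let $$H=48\,886\,437\,600=2^5\cdot 3^3\cdot 5^2\cdot 7^2\cdot 11\cdot 13\cdot 17\cdot 19,\qquad H'=64\,250\,746\,560=2^6\cdot 3^3\cdot 5\cdot 7\cdot 11\cdot 13\cdot 17\cdot 19\cdot 23.$$ Then $H<H'$ are consecutive highly composite numbers, with $$d(H)=3456,\qquad d(H')=3584,\qquad d(\gcd(H,H'))=1536,$$ so that $\dfrac{d(\gcd(H,H'))}{d(H)}=\dfrac49<\dfrac12$. Moreover this is the first such pair: for every pair $K<K'$ of consecutive highly composite numbers with $K<H$ one has $d(\gcd(K,K'))\ge\frac12 d(K)$.
   Context: $d(n)$ denotes the number of positive divisors of $n$. A positive integer $H$ is highly composite if $d(m)<d(H)$ for all integers $1\le m<H$. Two highly composite numbers $H<H'$ are consecutive if no highly composite number lies strictly between them. -}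

module Defs where

open import Data.Integer using (+_)
open import Data.List using (List; filter; length; map; upTo)
open import Data.List.Properties using (filter-some)
open import Data.List.Relation.Unary.Any using (here)
open import Data.Nat using (ℕ; suc; _≤_; _<_; NonZero; >-nonZero)
open import Data.Nat.Divisibility using (_∣?_; 1∣_)
open import Data.Rational using (ℚ; _/_)
open import Relation.Nullary using (¬_)

divisors : ℕ → List ℕ
divisors n = filter (_∣? n) (map suc (upTo n))

-- For n = 0 this is the junk value 0; below, d is only used at positive arguments.
d : ℕ → ℕ
d n = length (divisors n)

d-nonZero : (n : ℕ) .{{_ : NonZero n}} → NonZero (d n)
d-nonZero (suc k) = >-nonZero (filter-some (_∣? suc k) (here (1∣ suc k)))

d-ratio : (m n : ℕ) .{{_ : NonZero n}} → ℚ
d-ratio m n = _/_ (+ d m) (d n) {{d-nonZero n}}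

record HighlyComposite (H : ℕ) : Set where
  field
    positive : 1 ≤ H
    maximal  : (m : ℕ) → 1 ≤ m → m < H → d m < d H

record ConsecutiveHC (K K′ : ℕ) : Set where
  field
    lower     : HighlyComposite K
    upper     : HighlyComposite K′
    ordered   : K < K′
    noBetween : (m : ℕ) → K < m → m < K′ → ¬ HighlyComposite m

H : ℕ
H = 48886437600

H′ : ℕ
H′ = 64250746560

{-# OPTIONS --safe #-}
module Submission where

-- For every q and k there is a finite table of points (v , e) such that each q-rough n < H′ satisfies
-- v ≤ n and d n ≤ e for some point. It is computed by descending through the primes: a q-rough number is
-- q ^ a times a (q + 1)-rough one, which multiplies v by q ^ a and e by a + 1, and points dominated by others
-- are discarded. The recursion starts at q = 23, where a number with t prime factors, all at least q, is at
-- least q ^ t and has at most 2 ^ t divisors. Every point of the resulting table for q = 2 is dominated by one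
-- of 82 explicit numbers with increasing d, the last of which is H. So these are all the highly composite
-- numbers below H′, and the remaining claims are read off their factorisations.

open import Defs
open import Data.Integer using (+_)
open import Data.Nat using (ℕ; _*_; _^_; _<_)
open import Data.Nat.GCD using (gcd)
open import Data.Product using (_×_)
open import Data.Rational as ℚ using (½; _/_)
open import Relation.Binary.PropositionalEquality using (_≡_)

import Data.Integer as ℤ
import Data.Integer.Properties as ℤ
open import Data.List using (List; []; _∷_; _++_; filter; length; map; merge; upTo; zipWith)
open import Data.List.Membership.Propositional using (_∈_; find; lose)
open import Data.List.Membership.Propositional.Properties
  using (∈-map⁺; ∈-map⁻; ∈-++⁺ˡ; ∈-++⁺ʳ; ∈-++⁻; ∈-filter⁺; ∈-filter⁻; ∈-upTo⁺)
open import Data.List.Membership.Propositional.Properties.WithK using (unique∧set⇒bag)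
open import Data.List.Properties using (length-++; length-map)
open import Data.List.Relation.Binary.BagAndSetEquality using (∼bag⇒↭)
open import Data.List.Relation.Binary.Permutation.Propositional using (_↭_)
open import Data.List.Relation.Binary.Permutation.Propositional.Properties using (↭-length)
open import Data.List.Relation.Binary.Sublist.Propositional using (lookup)
open import Data.List.Relation.Binary.Sublist.Propositional.Properties using (⊆-mergeˡ; ⊆-mergeʳ)
open import Data.List.Relation.Unary.All as All using (All; []; _∷_; all?)
open import Data.List.Relation.Unary.AllPairs using ([]; _∷_)
open import Data.List.Relation.Unary.Any as Any using (Any; here; there; any?)
import Data.List.Relation.Unary.Any.Properties as Any
open import Data.List.Relation.Unary.Linked as Linked using (Linked; _∷_; linked?)
import Data.List.Relation.Unary.Linked.Properties as Linked
open import Data.List.Relation.Unary.Unique.DecPropositional using (unique?)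
open import Data.List.Relation.Unary.Unique.Propositional using (Unique)
import Data.List.Relation.Unary.Unique.Propositional.Properties as Unique
open import Data.Nat hiding (_/_)
open import Data.Nat.Coprimality using (Coprime; coprime-divisor)
open import Data.Nat.Divisibility
open import Data.Nat.GCD
open import Data.Nat.Induction using (<-rec)
open import Data.Nat.ListAction using (product)
open import Data.Nat.Primality
open import Data.Nat.Primality.Factorisation using (factorise)
open import Data.Nat.Properties
open import Data.Product using (∃; _,_; proj₁; proj₂)
import Data.Rational.Properties as ℚ
import Data.Rational.Unnormalised as ℚᵘ
import Data.Rational.Unnormalised.Properties as ℚᵘ
open import Data.Sum using (_⊎_; inj₁; inj₂)
open import Function.Bundles using (mk⇔)
open import Level using (0ℓ)
open import Relation.Binary.Core using (Rel)
open import Relation.Binary.Definitions using (Decidable)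
open import Relation.Binary.PropositionalEquality
  using (_≢_; refl; sym; trans; cong; cong₂; subst; subst₂; module ≡-Reasoning)
open import Relation.Nullary using (¬_; yes; no; contradiction)
open import Relation.Nullary.Decidable using (_×-dec_; from-yes)

-- Divisor counts and prime powers.

∤⇒coprime : ∀ {p k} → Prime p → p ∤ k → Coprime k p
∤⇒coprime pp p∤k (i∣k , i∣p) with prime⇒irreducible pp i∣p
... | inj₁ i≡1  = i≡1
... | inj₂ refl = contradiction i∣k p∤k

coprime-divisor-^ : ∀ {k p m} a → Coprime k p → k ∣ p ^ a * m → k ∣ m
coprime-divisor-^ {m = m} zero c k∣m = subst (_ ∣_) (*-identityˡ m) k∣m
coprime-divisor-^ {k} {p} {m} (suc a) c k∣ =
  coprime-divisor-^ a c (coprime-divisor c (subst (k ∣_) (*-assoc p (p ^ a) m) k∣))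

∣⇒∈divisors : ∀ {k n} .{{_ : NonZero n}} → k ∣ n → k ∈ divisors n
∣⇒∈divisors {zero}  {suc n} 0∣n = contradiction (0∣⇒≡0 0∣n) λ ()
∣⇒∈divisors {suc k} {suc n} k∣n = ∈-filter⁺ (_∣? suc n) (∈-map⁺ suc (∈-upTo⁺ (∣⇒≤ k∣n))) k∣n

∈divisors⇒∣ : ∀ {k n} → k ∈ divisors n → k ∣ n
∈divisors⇒∣ {n = n} k∈ = proj₂ (∈-filter⁻ (_∣? n) {xs = map suc (upTo n)} k∈)

divisors-unique : ∀ n → Unique (divisors n)
divisors-unique n = Unique.filter⁺ (_∣? n) (Unique.map⁺ suc-injective (Unique.upTo⁺ n))

-- A divisor of p ^ (a + 1) * m is p times a divisor of p ^ a * m, or prime to p and a divisor of m.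
d-prime-step : ∀ {p m} a → Prime p → .{{_ : NonZero m}} → p ∤ m →
               d (p ^ suc a * m) ≡ d (p ^ a * m) + d m
d-prime-step {p} {m} a pp p∤m = begin
  length (divisors (p ^ suc a * m)) ≡⟨ ↭-length partition ⟩
  length (multiples ++ divisors m)  ≡⟨ length-++ multiples ⟩
  length multiples + d m            ≡⟨ cong (_+ d m) (length-map (p *_) (divisors (p ^ a * m))) ⟩
  d (p ^ a * m) + d m               ∎
  where
  open ≡-Reasoning
  instance
    _ = prime⇒nonZero pp
    _ = m*n≢0 (p ^ a) m {{m^n≢0 p a}}
    _ = m*n≢0 (p ^ suc a) m {{m^n≢0 p (suc a)}}
  multiples : List ℕ
  multiples = map (p *_) (divisors (p ^ a * m))
  unique : Unique (multiples ++ divisors m)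
  unique = Unique.++⁺ (Unique.map⁺ (*-cancelˡ-≡ _ _ p) (divisors-unique (p ^ a * m))) (divisors-unique m) disjoint
    where
    disjoint : ∀ {k} → ¬ (k ∈ multiples × k ∈ divisors m)
    disjoint (k∈ , k∈′) with ∈-map⁻ (p *_) k∈
    ... | j , _ , refl = p∤m (∣-trans (m∣m*n j) (∈divisors⇒∣ k∈′))
  to : ∀ {k} → k ∈ divisors (p ^ suc a * m) → k ∈ multiples ++ divisors m
  to {k} k∈ with p ∣? k | ∈divisors⇒∣ k∈
  ... | yes (divides j refl) | k∣ rewrite *-comm j p =
    ∈-++⁺ˡ (∈-map⁺ (p *_) (∣⇒∈divisors (*-cancelˡ-∣ p (subst (p * j ∣_) (*-assoc p (p ^ a) m) k∣))))
  ... | no p∤k | k∣ =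
    ∈-++⁺ʳ multiples (∣⇒∈divisors (coprime-divisor-^ (suc a) (∤⇒coprime pp p∤k) k∣))
  from : ∀ {k} → k ∈ multiples ++ divisors m → k ∈ divisors (p ^ suc a * m)
  from k∈ with ∈-++⁻ multiples k∈
  ... | inj₂ k∈m = ∣⇒∈divisors (∣n⇒∣m*n (p ^ suc a) (∈divisors⇒∣ k∈m))
  ... | inj₁ k∈p with ∈-map⁻ (p *_) k∈p
  ...   | j , j∈ , refl = ∣⇒∈divisors (subst (p * j ∣_) (sym (*-assoc p (p ^ a) m)) (*-monoʳ-∣ p (∈divisors⇒∣ j∈)))
  partition : divisors (p ^ suc a * m) ↭ multiples ++ divisors m
  -- Two duplicate-free lists with the same members are permutations of each other, so their lengths
  -- agree.
  partition = ∼bag⇒↭ (unique∧set⇒bag (divisors-unique (p ^ suc a * m)) unique (mk⇔ to from))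

-- Induction on `a`: each further factor `p` contributes another `d m` divisors.
d-prime-power-* : ∀ {p m} a → Prime p → .{{_ : NonZero m}} → p ∤ m → d (p ^ a * m) ≡ suc a * d m
d-prime-power-* {m = m} zero pp p∤m = trans (cong d (*-identityˡ m)) (sym (*-identityˡ (d m)))
d-prime-power-* {p} {m} (suc a) pp p∤m = begin
  d (p ^ suc a * m)   ≡⟨ d-prime-step a pp p∤m ⟩
  d (p ^ a * m) + d m ≡⟨ cong (_+ d m) (d-prime-power-* a pp p∤m) ⟩
  suc a * d m + d m   ≡⟨ +-comm (suc a * d m) (d m) ⟩
  suc (suc a) * d m   ∎
  where open ≡-Reasoning

-- Splitting off prime powers, and a crude bound for rough numbers.

record PowerSplit (p n : ℕ) : Set where
  constructor split
  field
    exponent cofactor : ℕ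
    p∤cofactor        : p ∤ cofactor
    equation          : n ≡ p ^ exponent * cofactor

powerSplit : ∀ p → .{{NonTrivial p}} → ∀ n → .{{NonZero n}} → PowerSplit p n
powerSplit p n {{n≢0}} = <-rec (λ n → .{{NonZero n}} → PowerSplit p n) step n {{n≢0}}
  where
  step : ∀ n → (∀ {k} → k < n → .{{NonZero k}} → PowerSplit p k) → .{{NonZero n}} → PowerSplit p n
  step n rec with p ∣? n
  ... | no p∤n = split 0 n p∤n (sym (*-identityˡ n))
  step n rec {{n≢0}} | yes p∣n with rec (quotient-< p∣n) {{quotient≢0 p∣n}}
  ... | split a m p∤m eq = split (suc a) m p∤m (begin
    n                ≡⟨ m∣n⇒n≡quotient*m p∣n ⟩
    quotient p∣n * p ≡⟨ cong (_* p) eq ⟩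
    p ^ a * m * p    ≡⟨ *-comm (p ^ a * m) p ⟩
    p * (p ^ a * m)  ≡⟨ *-assoc p (p ^ a) m ⟨
    p ^ suc a * m    ∎)
    where open ≡-Reasoning

primeDivisor : ∀ n → .{{NonTrivial n}} → ∃ λ p → Prime p × p ∣ n
primeDivisor n@(2+ _) with factorise n
... | record { factors = p ∷ ps ; isFactorisation = eq ; factorsPrime = pp ∷ _ } =
  p , pp , subst (p ∣_) (sym eq) (m∣m*n _)

-- Serves as `a + 1 ≤ 2 ^ a`, which compares the divisor count of a prime power with that of `a`
-- distinct primes.
n<2^n : ∀ n → n < 2 ^ n
n<2^n zero    = ≤-refl
n<2^n (suc n) = +-mono-≤ (m^n>0 2 n) (≤-trans (n<2^n n) (m≤m+n _ 0))

-- n has some t prime factors counted with multiplicity, each at least q.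
rough-bound : ∀ q n → .{{NonZero n}} → q Rough n → ∃ λ t → q ^ t ≤ n × d n ≤ 2 ^ t
rough-bound q n {{n≢0}} = <-rec (λ n → .{{NonZero n}} → q Rough n → ∃ λ t → q ^ t ≤ n × d n ≤ 2 ^ t) step n {{n≢0}}
  where
  step : ∀ n → (∀ {k} → k < n → .{{NonZero k}} → q Rough k → ∃ λ t → q ^ t ≤ k × d k ≤ 2 ^ t) →
         .{{NonZero n}} → q Rough n → ∃ λ t → q ^ t ≤ n × d n ≤ 2 ^ t
  step 1 rec rough = 0 , ≤-refl , ≤-refl
  step n@(2+ _) rec rough with primeDivisor n
  ... | p , pp , p∣n with powerSplit p {{prime⇒nonTrivial pp}} n
  ...   | split zero m p∤m eq = contradiction (subst (p ∣_) (trans eq (*-identityˡ m)) p∣n) p∤m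
  -- The factor `p ^ suc a` accounts for `suc a` primes; the cofactor is smaller and still
  -- `q`-rough, so induction supplies its `t`.
  ...   | split (suc a) m p∤m eq = suc a + t , q^≤n , dn≤
    where
    instance
      _ = prime⇒nonZero pp
      _ = prime⇒nonTrivial pp
      m≢0 : NonZero m
      m≢0 = ≢-nonZero λ { refl → p∤m (p ∣0) }
    m<n : m < n
    m<n = subst (m <_) (sym eq) (subst (_< p ^ suc a * m) (*-identityˡ m)
            (*-monoˡ-< m (≤-<-trans (m^n>0 p a) (subst (_< p ^ suc a) (*-identityˡ (p ^ a))
              (*-monoˡ-< (p ^ a) {{m^n≢0 p a}} (nonTrivial⇒n>1 p))))))
    ih = rec m<n (rough∧∣⇒rough rough (subst (m ∣_) (sym eq) (n∣m*n (p ^ suc a))))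
    t = proj₁ ih
    q≤p : q ≤ p
    q≤p = ≮⇒≥ λ p<q → rough (hasNonTrivialDivisor p<q p∣n)
    q^≤n : q ^ (suc a + t) ≤ n
    q^≤n = begin
      q ^ (suc a + t)   ≡⟨ ^-distribˡ-+-* q (suc a) t ⟩
      q ^ suc a * q ^ t ≤⟨ *-mono-≤ (^-monoˡ-≤ (suc a) q≤p) (proj₁ (proj₂ ih)) ⟩
      p ^ suc a * m     ≡⟨ eq ⟨
      n                 ∎
      where open ≤-Reasoning
    dn≤ : d n ≤ 2 ^ (suc a + t)
    dn≤ = begin
      d n                 ≡⟨ cong d eq ⟩
      d (p ^ suc a * m)   ≡⟨ d-prime-power-* (suc a) pp p∤m ⟩
      suc (suc a) * d m   ≤⟨ *-mono-≤ (n<2^n (suc a)) (proj₂ (proj₂ ih)) ⟩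
      2 ^ suc a * 2 ^ t   ≡⟨ ^-distribˡ-+-* 2 (suc a) t ⟨
      2 ^ (suc a + t)     ∎
      where open ≤-Reasoning

-- Points, domination and pruning.

-- A point (v , e) is a hypothetical number v with e divisors; no actual such number need exist.
Point : Set
Point = ℕ × ℕ

infix 4 _⊒_ _⊒?_ _≼?_

-- The directions are opposite because a smaller number with at least as many divisors makes the
-- other one irrelevant.
_⊒_ : Rel Point 0ℓ
(v , e) ⊒ (w , f) = v ≤ w × f ≤ e

_⊒?_ : Decidable _⊒_
(v , e) ⊒? (w , f) = v ≤? w ×-dec f ≤? e

⊒-trans : ∀ {x y z} → x ⊒ y → y ⊒ z → x ⊒ z
⊒-trans (v≤w , f≤e) (w≤u , g≤f) = ≤-trans v≤w w≤u , ≤-trans g≤f f≤e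

_≼?_ : Decidable (λ (x y : Point) → proj₁ x ≤ proj₁ y)
x ≼? y = proj₁ x ≤? proj₁ y

Covers : List Point → Point → Set
Covers T x = Any (_⊒ x) T

-- Correct for any list; on one sorted by the first component, as merge yields, nothing dominated survives.
pruneAfter : Point → List Point → List Point
pruneAfter x []       = []
pruneAfter x (y ∷ ys) with x ⊒? y
... | yes _ = pruneAfter x ys
... | no  _ = y ∷ pruneAfter y ys

prune : List Point → List Point
prune []       = []
prune (x ∷ xs) = x ∷ pruneAfter x xs

-- A discarded point is dominated by the last one kept, which by transitivity covers whatever the
-- discarded point covered.
pruneAfter-covers : ∀ {z} x ys → Covers (x ∷ ys) z → Covers (x ∷ pruneAfter x ys) z
pruneAfter-covers x [] c = c
pruneAfter-covers x (y ∷ ys) c with x ⊒? y | c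
... | yes x⊒y | here x⊒z          = here x⊒z
... | yes x⊒y | there (here y⊒z)  = here (⊒-trans x⊒y y⊒z)
... | yes x⊒y | there (there c′)  = pruneAfter-covers x ys (there c′)
... | no  _   | here x⊒z          = here x⊒z
... | no  _   | there c′          = there (pruneAfter-covers y ys c′)

prune-covers : ∀ {z} xs → Covers xs z → Covers (prune xs) z
prune-covers (x ∷ xs) = pruneAfter-covers x xs

-- Tables covering all rough numbers below a bound.

module Table (B A : ℕ) (B≤2^A : B ≤ 2 ^ A) where

  below : List Point → List Point
  below = filter (λ x → proj₁ x <? B)

  scale : ℕ → ℕ → Point → Point
  scale p a (v , e) = p ^ a * v , suc a * e

  -- Exponents enter one at a time, each scaling the original `T`; pruning after every merge keeps
  -- dominated points from accumulating.
  adjoin : ℕ → ℕ → List Point → List Point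
  adjoin p zero    T = T
  adjoin p (suc a) T = prune (merge _≼?_ (adjoin p a T) (below (map (scale p (suc a)) T)))

  -- `k` counts the steps from `q` up to the base `q + k`, where the points come from `rough-bound`.
  table : ℕ → ℕ → List Point
  table q zero    = below (map (λ t → q ^ t , 2 ^ t) (upTo A))
  table q (suc k) with prime? q
  ... | yes _ = adjoin q A (table (suc q) k)
  ... | no  _ = table (suc q) k

  -- A point covering `n` has first component at most `n`, so the filter keeps it.
  below-covers : ∀ {T n e} → n < B → Covers T (n , e) → Covers (below T) (n , e)
  below-covers {T} n<B c with find c
  ... | x , x∈ , x⊒ = lose (∈-filter⁺ (λ x → proj₁ x <? B) x∈ (≤-<-trans (proj₁ x⊒) n<B)) x⊒

  scale-covers : ∀ {T n e} p a → Covers T (n , e) → Covers (map (scale p a) T) (p ^ a * n , suc a * e)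
  scale-covers p a c = Any.map⁺ (Any.map (λ (v≤n , e≤f) → *-monoʳ-≤ (p ^ a) v≤n , *-monoʳ-≤ (suc a) e≤f) c)

  -- The exponent `a` is either the newest one or was treated earlier; `merge` retains both lists
  -- and pruning preserves covering.
  adjoin-covers : ∀ {T n e} p A′ a → a ≤ A′ → p ^ a * n < B → Covers T (n , e) →
                  Covers (adjoin p A′ T) (p ^ a * n , suc a * e)
  adjoin-covers {T} {n} {e} p zero .zero z≤n _ c =
    subst (Covers T) (sym (cong₂ _,_ (*-identityˡ n) (*-identityˡ e))) c
  adjoin-covers {T} p (suc A′) a a≤ pn<B c = prune-covers _ (merged (m≤n⇒m<n∨m≡n a≤))
    where
    new = below (map (scale p (suc A′)) T)
    merged : a < suc A′ ⊎ a ≡ suc A′ → Covers (merge _≼?_ (adjoin p A′ T) new) _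
    merged (inj₁ (s≤s a≤A′)) = let x , x∈ , x⊒ = find (adjoin-covers p A′ a a≤A′ pn<B c) in
      lose (lookup (⊆-mergeˡ _≼?_ (adjoin p A′ T) new) x∈) x⊒
    merged (inj₂ refl) = let x , x∈ , x⊒ = find (below-covers pn<B (scale-covers p (suc A′) c)) in
      lose (lookup (⊆-mergeʳ _≼?_ (adjoin p A′ T) new) x∈) x⊒

  -- Because `q` is at least 2 and `B ≤ 2 ^ A`, no exponent beyond `A` has to be adjoined.
  exponent<A : ∀ {q n} t → .{{NonTrivial q}} → q ^ t ≤ n → n < B → t < A
  exponent<A {q} {n} t q^t≤n n<B = ≰⇒> λ A≤t → <-irrefl refl (begin-strict
    n     <⟨ n<B ⟩
    B     ≤⟨ B≤2^A ⟩
    2 ^ A ≤⟨ ^-monoʳ-≤ 2 A≤t ⟩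
    2 ^ t ≤⟨ ^-monoˡ-≤ t (nonTrivial⇒n>1 q) ⟩
    q ^ t ≤⟨ q^t≤n ⟩
    n     ∎)
    where open ≤-Reasoning

  table-covers : ∀ k q n → .{{NonTrivial q}} → .{{NonZero n}} → q Rough n → n < B →
                 Covers (table q k) (n , d n)
  table-covers zero q n rough n<B with rough-bound q n rough
  ... | t , q^t≤n , dn≤2^t = below-covers n<B
    (lose (∈-map⁺ (λ t → q ^ t , 2 ^ t) (∈-upTo⁺ (exponent<A t q^t≤n n<B))) (q^t≤n , dn≤2^t))
  table-covers (suc k) q@(2+ _) n rough n<B with prime? q
  -- A divisor `q` of a `q`-rough number is prime, so a composite `q` does not divide `n` and can be
  -- skipped.
  ... | no ¬pq = table-covers k (suc q) n (∤⇒rough-suc (λ q∣n → ¬pq (rough∧∣⇒prime rough q∣n)) rough) n<B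
  ... | yes pq with powerSplit q n
  ...   | split a m q∤m refl = subst (λ e → Covers _ (q ^ a * m , e)) (sym (d-prime-power-* a pq q∤m))
            (adjoin-covers q A a (<⇒≤ (exponent<A a (m≤m*n (q ^ a) m) n<B)) n<B
              (table-covers k (suc q) m (∤⇒rough-suc q∤m (rough∧∣⇒rough rough (n∣m*n (q ^ a))))
                (≤-<-trans (m≤n*m m (q ^ a) {{m^n≢0 q a}}) n<B)))
    where
    instance
      m≢0 : NonZero m
      m≢0 = ≢-nonZero λ { refl → q∤m (q ∣0) }

-- Numbers given by exponent lists: divisor counts and gcds.

prime∣^⇒prime∣ : ∀ {p} q a → Prime p → p ∣ q ^ a → p ∣ q
prime∣^⇒prime∣ q zero    pp p∣1 = contradiction (subst Prime (∣1⇒≡1 p∣1) pp) ¬prime[1]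
prime∣^⇒prime∣ q (suc a) pp p∣  with euclidsLemma q (q ^ a) pp p∣
... | inj₁ p∣q   = p∣q
... | inj₂ p∣q^a = prime∣^⇒prime∣ q a pp p∣q^a

prime∣prime⇒≡ : ∀ {p q} → Prime p → Prime q → p ∣ q → p ≡ q
prime∣prime⇒≡ pp pq p∣q with prime⇒irreducible pq p∣q
... | inj₁ refl = contradiction pp ¬prime[1]
... | inj₂ p≡q  = p≡q

-- Exponents in excess of the list of primes are ignored, missing ones count as 0.
value : List ℕ → List ℕ → ℕ
value ps as = product (zipWith _^_ ps as)

divisorCount : List ℕ → List ℕ → ℕ
divisorCount ps as = product (zipWith (λ _ a → suc a) ps as)

value-nonZero : ∀ {ps} as → All Prime ps → NonZero (value ps as)
value-nonZero {[]}     as       []         = _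
value-nonZero {p ∷ ps} []       (_ ∷ _)    = _
value-nonZero {p ∷ ps} (a ∷ as) (pp ∷ pps) =
  m*n≢0 (p ^ a) (value ps as) {{m^n≢0 p a {{prime⇒nonZero pp}}}} {{value-nonZero as pps}}

∤value : ∀ {p ps} as → Prime p → All Prime ps → All (p ≢_) ps → p ∤ value ps as
∤value {ps = []}     as pp _ _ p∣1 = contradiction (subst Prime (∣1⇒≡1 p∣1) pp) ¬prime[1]
∤value {ps = q ∷ ps} [] pp _ _ p∣1 = contradiction (subst Prime (∣1⇒≡1 p∣1) pp) ¬prime[1]
∤value {ps = q ∷ ps} (a ∷ as) pp (pq ∷ pqs) (p≢q ∷ p≢qs) p∣ with euclidsLemma (q ^ a) (value ps as) pp p∣
... | inj₁ p∣q^a = p≢q (prime∣prime⇒≡ pp pq (prime∣^⇒prime∣ q a pp p∣q^a))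
... | inj₂ p∣v   = ∤value as pp pqs p≢qs p∣v

-- Replaces the enumeration of all candidates up to the number by a short product, which makes the
-- later checks computable.
d-value : ∀ {ps} as → All Prime ps → Unique ps → d (value ps as) ≡ divisorCount ps as
d-value {[]}     as       _          _          = refl
d-value {p ∷ ps} []       _          _          = refl
d-value {p ∷ ps} (a ∷ as) (pp ∷ pps) (p≢ ∷ u) = begin
  d (p ^ a * value ps as)     ≡⟨ d-prime-power-* a pp {{value-nonZero as pps}} (∤value as pp pps p≢) ⟩
  suc a * d (value ps as)     ≡⟨ cong (suc a *_) (d-value as pps u) ⟩
  suc a * divisorCount ps as  ∎
  where open ≡-Reasoning

-- The left gcd divides `m`, hence is coprime to `p`, and the power of `p` can be cancelled.
gcd-prime-to : ∀ {p m n} b → Prime p → p ∤ m → gcd m (p ^ b * n) ≡ gcd m n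
gcd-prime-to {p} {m} {n} b pp p∤m = ∣-antisym
  (gcd-greatest g∣m (coprime-divisor-^ b (∤⇒coprime pp λ p∣g → p∤m (∣-trans p∣g g∣m)) (gcd[m,n]∣n m _)))
  (gcd-greatest (gcd[m,n]∣m m n) (∣n⇒∣m*n (p ^ b) (gcd[m,n]∣n m n)))
  where
  g∣m : gcd m (p ^ b * n) ∣ m
  g∣m = gcd[m,n]∣m m (p ^ b * n)

-- Common factors `p` are pulled out until one exponent is 0; then `gcd-prime-to` removes what is
-- left of the other power.
gcd-prime-powers : ∀ {p m n} a b → Prime p → p ∤ m → p ∤ n →
                   gcd (p ^ a * m) (p ^ b * n) ≡ p ^ (a ⊓ b) * gcd m n
gcd-prime-powers {p} {m} {n} zero b pp p∤m p∤n rewrite *-identityˡ m =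
  trans (gcd-prime-to b pp p∤m) (sym (*-identityˡ _))
gcd-prime-powers {p} {m} {n} (suc a) zero pp p∤m p∤n rewrite *-identityˡ n = begin
  gcd (p ^ suc a * m) n ≡⟨ gcd-comm (p ^ suc a * m) n ⟩
  gcd n (p ^ suc a * m) ≡⟨ gcd-prime-to (suc a) pp p∤n ⟩
  gcd n m               ≡⟨ gcd-comm n m ⟩
  gcd m n               ≡⟨ *-identityˡ _ ⟨
  1 * gcd m n           ∎
  where open ≡-Reasoning
gcd-prime-powers {p} {m} {n} (suc a) (suc b) pp p∤m p∤n = begin
  gcd (p * p ^ a * m) (p * p ^ b * n)     ≡⟨ cong₂ gcd (*-assoc p (p ^ a) m) (*-assoc p (p ^ b) n) ⟩
  gcd (p * (p ^ a * m)) (p * (p ^ b * n)) ≡⟨ c*gcd[m,n]≡gcd[cm,cn] p _ _ ⟨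
  p * gcd (p ^ a * m) (p ^ b * n)         ≡⟨ cong (p *_) (gcd-prime-powers a b pp p∤m p∤n) ⟩
  p * (p ^ (a ⊓ b) * gcd m n)             ≡⟨ *-assoc p _ _ ⟨
  p * p ^ (a ⊓ b) * gcd m n               ∎
  where open ≡-Reasoning

gcd-value : ∀ {ps} as bs → All Prime ps → Unique ps →
            gcd (value ps as) (value ps bs) ≡ value ps (zipWith _⊓_ as bs)
gcd-value {[]}     as       bs       _ _ = refl
gcd-value {p ∷ ps} []       bs       _ _ = gcd-zeroˡ (value (p ∷ ps) bs)
gcd-value {p ∷ ps} (a ∷ as) []       _ _ = gcd-zeroʳ (value (p ∷ ps) (a ∷ as))
gcd-value {p ∷ ps} (a ∷ as) (b ∷ bs) (pp ∷ pps) (p≢ ∷ u) = trans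
  (gcd-prime-powers a b pp (∤value as pp pps p≢) (∤value bs pp pps p≢))
  (cong (p ^ (a ⊓ b) *_) (gcd-value as bs pps u))

-- Neighbours in increasing lists.

-- `R` is demanded of neighbours only, since the relation `Close` used below is not transitive.
Increasing : Rel ℕ 0ℓ → List ℕ → Set
Increasing R = Linked (λ x y → x < y × R x y)

head<tail : ∀ {R x xs y} → Increasing R (x ∷ xs) → y ∈ xs → x < y
head<tail ((x<y , _) ∷ _)   (here refl) = x<y
head<tail ((x<z , _) ∷ inc) (there y∈)  = <-trans x<z (head<tail inc y∈)

-- If `y` were not the neighbour of `x`, the entry right after `x` would lie strictly between them.
consecutive⇒related : ∀ {R xs x y} → Increasing R xs → x ∈ xs → y ∈ xs → x < y →
                      (∀ z → z ∈ xs → x < z → ¬ z < y) → R x y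
consecutive⇒related inc             (here refl) (here refl)         x<y _ = contradiction x<y (<-irrefl refl)
consecutive⇒related ((_ , r) ∷ _)   (here refl) (there (here refl)) x<y _ = r
consecutive⇒related ((x<z , _) ∷ i) (here refl) (there (there y∈))  x<y none =
  contradiction (head<tail i y∈) (none _ (there (here refl)) x<z)
consecutive⇒related inc             (there x∈)  (here refl)         x<y _ =
  contradiction x<y (<-asym (head<tail inc x∈))
consecutive⇒related inc             (there x∈)  (there y∈)          x<y none =
  consecutive⇒related (Linked.tail inc) x∈ y∈ x<y (λ z z∈ → none z (there z∈))

increasing⇒related : ∀ {R xs x y} → (∀ {u v w} → R u v → R v w → R u w) → Increasing R xs →
                     x ∈ xs → y ∈ xs → x < y → R x y
increasing⇒related tr inc (here refl) (here refl) x<y = contradiction x<y (<-irrefl refl)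
increasing⇒related tr inc (there x∈)  (here refl) x<y = contradiction x<y (<-asym (head<tail inc x∈))
increasing⇒related tr inc (there x∈)  (there y∈)  x<y = increasing⇒related tr (Linked.tail inc) x∈ y∈ x<y
increasing⇒related tr ((_ , r) ∷ _)   (here refl) (there (here refl)) x<y = r
increasing⇒related tr ((_ , r) ∷ inc) (here refl) (there y∈@(there y∈′)) x<y =
  tr r (increasing⇒related tr inc (here refl) y∈ (head<tail inc y∈′))

-- A rational inequality from a natural one.

-- In the unnormalised rationals the comparison is cross multiplication with denominators 2 and 1.
½*-≤ : ∀ x y → x ≤ 2 * y → ½ ℚ.* (+ x / 1) ℚ.≤ + y / 1
½*-≤ x y x≤2y = ℚ.toℚᵘ-cancel-≤ (begin
  ℚ.toℚᵘ (½ ℚ.* (+ x / 1))       ≃⟨ ℚ.toℚᵘ-homo-* ½ (+ x / 1) ⟩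
  ℚ.toℚᵘ ½ ℚᵘ.* ℚ.toℚᵘ (+ x / 1) ≃⟨ ℚᵘ.*-congˡ {ℚ.toℚᵘ ½} (ℚ.toℚᵘ-fromℚᵘ (ℚᵘ.mkℚᵘ (+ x) 0)) ⟩
  ℚ.toℚᵘ ½ ℚᵘ.* ℚᵘ.mkℚᵘ (+ x) 0  ≤⟨ ℚᵘ.*≤* (subst₂ ℤ._≤_ left right (ℤ.+≤+ x≤2y)) ⟩
  ℚᵘ.mkℚᵘ (+ y) 0                ≃⟨ ℚ.toℚᵘ-fromℚᵘ (ℚᵘ.mkℚᵘ (+ y) 0) ⟨
  ℚ.toℚᵘ (+ y / 1)               ∎)
  where
  open ℚᵘ.≤-Reasoning
  left : + x ≡ + 1 ℤ.* + x ℤ.* + 1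
  left = sym (trans (ℤ.*-identityʳ _) (ℤ.*-identityˡ _))
  right : + (2 * y) ≡ + y ℤ.* + 2
  right = trans (cong +_ (*-comm 2 y)) (ℤ.pos-* y 2)

-- Recognising the highly composite numbers from a covering list.

Close : Rel ℕ 0ℓ
Close x y = d x < d y × d x ≤ 2 * d (gcd x y)

module Records
  (records : List ℕ) (top B : ℕ)
  (positive : ∀ {h} → h ∈ records → 1 ≤ h) (increasing : Increasing Close records)
  (top∈ : top ∈ records) (≤top : ∀ {h} → h ∈ records → h ≤ top)
  (top<B : top < B) (d-top<d-B : d top < d B)
  (cover : ∀ m → 1 ≤ m → m < B → ∃ λ h → h ∈ records × h ≤ m × d m ≤ d h)
  where

  d-mono : ∀ {h k} → h ∈ records → k ∈ records → h < k → d h < d k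
  d-mono = increasing⇒related <-trans (Linked.map (λ (x<y , dx<dy , _) → x<y , dx<dy) increasing)

  d≤d-top : ∀ {h} → h ∈ records → d h ≤ d top
  d≤d-top h∈ with m≤n⇒m<n∨m≡n (≤top h∈)
  ... | inj₁ h<top = <⇒≤ (d-mono h∈ top∈ h<top)
  ... | inj₂ refl  = ≤-refl

  -- Any `m < h` is covered by a record `k ≤ m`, and `d` grows strictly along the records from `k`
  -- to `h`.
  ∈⇒HC : ∀ {h} → h ∈ records → HighlyComposite h
  ∈⇒HC h∈ = record
    { positive = positive h∈
    ; maximal  = λ m 1≤m m<h →
        let k , k∈ , k≤m , dm≤dk = cover m 1≤m (<-trans m<h (≤-<-trans (≤top h∈) top<B))
        in ≤-<-trans dm≤dk (d-mono k∈ h∈ (≤-<-trans k≤m m<h))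
    }

  -- The record covering `m` has at least `d m` divisors, so maximality of `m` forbids it to be
  -- smaller than `m`.
  HC⇒∈ : ∀ {m} → HighlyComposite m → m < B → m ∈ records
  HC⇒∈ {m} hc m<B with cover m (HighlyComposite.positive hc) m<B
  ... | k , k∈ , k≤m , dm≤dk with m≤n⇒m<n∨m≡n k≤m
  ...   | inj₂ refl = k∈
  ...   | inj₁ k<m  = contradiction (HighlyComposite.maximal hc k (positive k∈) k<m) (≤⇒≯ dm≤dk)

  top-B-consecutive : ConsecutiveHC top B
  top-B-consecutive = record
    { lower     = ∈⇒HC top∈
    ; upper     = record
      { positive = ≤-trans (s≤s z≤n) top<B
      ; maximal  = λ m 1≤m m<B →
          let h , h∈ , _ , dm≤dh = cover m 1≤m m<B
          -- Below `B` no divisor count exceeds `d top`, which is less than `d B`.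
          in ≤-<-trans (≤-trans dm≤dh (d≤d-top h∈)) d-top<d-B
      }
    ; ordered   = top<B
    ; noBetween = λ m top<m m<B hc → <⇒≱ top<m (≤top (HC⇒∈ hc m<B))
    }

  consecutive⇒close : ∀ {K K′} → ConsecutiveHC K K′ → K < top → Close K K′
  consecutive⇒close {K} {K′} c K<top =
    consecutive⇒related increasing
      (HC⇒∈ lower (<-trans K<top top<B)) (HC⇒∈ upper (≤-<-trans K′≤top top<B)) ordered
      (λ z z∈ K<z z<K′ → noBetween z K<z z<K′ (∈⇒HC z∈))
    where
    open ConsecutiveHC c
    K′≤top : K′ ≤ top
    -- Otherwise `top`, itself highly composite, would separate `K` from `K′`.
    K′≤top = ≮⇒≥ λ top<K′ → noBetween top K<top top<K′ (∈⇒HC top∈)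

-- The explicit list of records and its verification.

primes : List ℕ
primes = 2 ∷ 3 ∷ 5 ∷ 7 ∷ 11 ∷ 13 ∷ 17 ∷ 19 ∷ 23 ∷ []

primes-prime : All Prime primes
primes-prime = from-yes (all? prime? primes)

primes-unique : Unique primes
primes-unique = from-yes (unique? _≟_ primes)

-- Exponent lists of 1, 2, 4, 6, 12, 24 and so on up to `H`, in increasing order; the empty list
-- stands for 1.
exponents : List (List ℕ)
exponents =
      [] ∷ (1 ∷ []) ∷ (2 ∷ []) ∷ (1 ∷ 1 ∷ []) ∷ (2 ∷ 1 ∷ []) ∷ (3 ∷ 1 ∷ []) ∷ (2 ∷ 2 ∷ []) ∷ (4 ∷ 1 ∷ [])
    ∷ (2 ∷ 1 ∷ 1 ∷ []) ∷ (3 ∷ 1 ∷ 1 ∷ []) ∷ (2 ∷ 2 ∷ 1 ∷ []) ∷ (4 ∷ 1 ∷ 1 ∷ []) ∷ (3 ∷ 2 ∷ 1 ∷ [])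
    ∷ (4 ∷ 2 ∷ 1 ∷ []) ∷ (3 ∷ 1 ∷ 1 ∷ 1 ∷ []) ∷ (2 ∷ 2 ∷ 1 ∷ 1 ∷ []) ∷ (4 ∷ 1 ∷ 1 ∷ 1 ∷ [])
    ∷ (3 ∷ 2 ∷ 1 ∷ 1 ∷ []) ∷ (4 ∷ 2 ∷ 1 ∷ 1 ∷ []) ∷ (3 ∷ 3 ∷ 1 ∷ 1 ∷ []) ∷ (5 ∷ 2 ∷ 1 ∷ 1 ∷ [])
    ∷ (4 ∷ 3 ∷ 1 ∷ 1 ∷ []) ∷ (6 ∷ 2 ∷ 1 ∷ 1 ∷ []) ∷ (4 ∷ 2 ∷ 2 ∷ 1 ∷ []) ∷ (3 ∷ 2 ∷ 1 ∷ 1 ∷ 1 ∷ [])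
    ∷ (4 ∷ 4 ∷ 1 ∷ 1 ∷ []) ∷ (5 ∷ 2 ∷ 2 ∷ 1 ∷ []) ∷ (4 ∷ 2 ∷ 1 ∷ 1 ∷ 1 ∷ []) ∷ (3 ∷ 3 ∷ 1 ∷ 1 ∷ 1 ∷ [])
    ∷ (5 ∷ 2 ∷ 1 ∷ 1 ∷ 1 ∷ []) ∷ (4 ∷ 3 ∷ 1 ∷ 1 ∷ 1 ∷ []) ∷ (6 ∷ 2 ∷ 1 ∷ 1 ∷ 1 ∷ [])
    ∷ (4 ∷ 2 ∷ 2 ∷ 1 ∷ 1 ∷ []) ∷ (5 ∷ 3 ∷ 1 ∷ 1 ∷ 1 ∷ []) ∷ (4 ∷ 4 ∷ 1 ∷ 1 ∷ 1 ∷ [])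
    ∷ (5 ∷ 2 ∷ 2 ∷ 1 ∷ 1 ∷ []) ∷ (6 ∷ 3 ∷ 1 ∷ 1 ∷ 1 ∷ []) ∷ (4 ∷ 2 ∷ 1 ∷ 1 ∷ 1 ∷ 1 ∷ [])
    ∷ (3 ∷ 3 ∷ 1 ∷ 1 ∷ 1 ∷ 1 ∷ []) ∷ (5 ∷ 2 ∷ 1 ∷ 1 ∷ 1 ∷ 1 ∷ []) ∷ (4 ∷ 3 ∷ 1 ∷ 1 ∷ 1 ∷ 1 ∷ [])
    ∷ (6 ∷ 2 ∷ 1 ∷ 1 ∷ 1 ∷ 1 ∷ []) ∷ (4 ∷ 2 ∷ 2 ∷ 1 ∷ 1 ∷ 1 ∷ []) ∷ (5 ∷ 3 ∷ 1 ∷ 1 ∷ 1 ∷ 1 ∷ [])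
    ∷ (4 ∷ 4 ∷ 1 ∷ 1 ∷ 1 ∷ 1 ∷ []) ∷ (5 ∷ 2 ∷ 2 ∷ 1 ∷ 1 ∷ 1 ∷ []) ∷ (6 ∷ 3 ∷ 1 ∷ 1 ∷ 1 ∷ 1 ∷ [])
    ∷ (4 ∷ 3 ∷ 2 ∷ 1 ∷ 1 ∷ 1 ∷ []) ∷ (6 ∷ 2 ∷ 2 ∷ 1 ∷ 1 ∷ 1 ∷ []) ∷ (7 ∷ 3 ∷ 1 ∷ 1 ∷ 1 ∷ 1 ∷ [])
    ∷ (5 ∷ 3 ∷ 2 ∷ 1 ∷ 1 ∷ 1 ∷ []) ∷ (4 ∷ 4 ∷ 2 ∷ 1 ∷ 1 ∷ 1 ∷ []) ∷ (4 ∷ 3 ∷ 1 ∷ 1 ∷ 1 ∷ 1 ∷ 1 ∷ [])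
    ∷ (6 ∷ 3 ∷ 2 ∷ 1 ∷ 1 ∷ 1 ∷ []) ∷ (4 ∷ 2 ∷ 2 ∷ 1 ∷ 1 ∷ 1 ∷ 1 ∷ []) ∷ (5 ∷ 3 ∷ 1 ∷ 1 ∷ 1 ∷ 1 ∷ 1 ∷ [])
    ∷ (4 ∷ 4 ∷ 1 ∷ 1 ∷ 1 ∷ 1 ∷ 1 ∷ []) ∷ (5 ∷ 2 ∷ 2 ∷ 1 ∷ 1 ∷ 1 ∷ 1 ∷ []) ∷ (6 ∷ 3 ∷ 1 ∷ 1 ∷ 1 ∷ 1 ∷ 1 ∷ [])
    ∷ (4 ∷ 3 ∷ 2 ∷ 1 ∷ 1 ∷ 1 ∷ 1 ∷ []) ∷ (6 ∷ 2 ∷ 2 ∷ 1 ∷ 1 ∷ 1 ∷ 1 ∷ []) ∷ (7 ∷ 3 ∷ 1 ∷ 1 ∷ 1 ∷ 1 ∷ 1 ∷ [])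
    ∷ (5 ∷ 3 ∷ 2 ∷ 1 ∷ 1 ∷ 1 ∷ 1 ∷ []) ∷ (4 ∷ 4 ∷ 2 ∷ 1 ∷ 1 ∷ 1 ∷ 1 ∷ [])
    ∷ (4 ∷ 3 ∷ 1 ∷ 1 ∷ 1 ∷ 1 ∷ 1 ∷ 1 ∷ []) ∷ (6 ∷ 3 ∷ 2 ∷ 1 ∷ 1 ∷ 1 ∷ 1 ∷ [])
    ∷ (5 ∷ 4 ∷ 2 ∷ 1 ∷ 1 ∷ 1 ∷ 1 ∷ []) ∷ (5 ∷ 3 ∷ 1 ∷ 1 ∷ 1 ∷ 1 ∷ 1 ∷ 1 ∷ [])
    ∷ (4 ∷ 4 ∷ 1 ∷ 1 ∷ 1 ∷ 1 ∷ 1 ∷ 1 ∷ []) ∷ (6 ∷ 4 ∷ 2 ∷ 1 ∷ 1 ∷ 1 ∷ 1 ∷ [])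
    ∷ (5 ∷ 2 ∷ 2 ∷ 1 ∷ 1 ∷ 1 ∷ 1 ∷ 1 ∷ []) ∷ (6 ∷ 3 ∷ 1 ∷ 1 ∷ 1 ∷ 1 ∷ 1 ∷ 1 ∷ [])
    ∷ (4 ∷ 3 ∷ 2 ∷ 1 ∷ 1 ∷ 1 ∷ 1 ∷ 1 ∷ []) ∷ (6 ∷ 2 ∷ 2 ∷ 1 ∷ 1 ∷ 1 ∷ 1 ∷ 1 ∷ [])
    ∷ (7 ∷ 3 ∷ 1 ∷ 1 ∷ 1 ∷ 1 ∷ 1 ∷ 1 ∷ []) ∷ (5 ∷ 3 ∷ 2 ∷ 1 ∷ 1 ∷ 1 ∷ 1 ∷ 1 ∷ [])
    ∷ (4 ∷ 4 ∷ 2 ∷ 1 ∷ 1 ∷ 1 ∷ 1 ∷ 1 ∷ []) ∷ (6 ∷ 3 ∷ 2 ∷ 1 ∷ 1 ∷ 1 ∷ 1 ∷ 1 ∷ [])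
    ∷ (5 ∷ 4 ∷ 2 ∷ 1 ∷ 1 ∷ 1 ∷ 1 ∷ 1 ∷ []) ∷ (7 ∷ 3 ∷ 2 ∷ 1 ∷ 1 ∷ 1 ∷ 1 ∷ 1 ∷ [])
    ∷ (6 ∷ 4 ∷ 2 ∷ 1 ∷ 1 ∷ 1 ∷ 1 ∷ 1 ∷ []) ∷ (5 ∷ 3 ∷ 2 ∷ 2 ∷ 1 ∷ 1 ∷ 1 ∷ 1 ∷ []) ∷ []

records : List ℕ
records = map (value primes) exponents

d≡ : ∀ as → d (value primes as) ≡ divisorCount primes as
d≡ as = d-value as primes-prime primes-unique

-- Moves order and closeness to exponent lists, where gcd is the componentwise minimum and all three
-- conditions are cheap to decide.
Step : Rel (List ℕ) 0ℓ
Step as bs = value primes as < value primes bs × divisorCount primes as < divisorCount primes bs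
  × divisorCount primes as ≤ 2 * divisorCount primes (zipWith _⊓_ as bs)

step? : Decidable Step
step? as bs = _ <? _ ×-dec _ <? _ ×-dec _ ≤? _

step⇒close : ∀ {as bs} → Step as bs → value primes as < value primes bs × Close (value primes as) (value primes bs)
step⇒close {as} {bs} (v< , c< , c≤)
  rewrite gcd-value as bs primes-prime primes-unique | d≡ as | d≡ bs | d≡ (zipWith _⊓_ as bs) = v< , c< , c≤

exponents-linked : Linked Step exponents
exponents-linked = from-yes (linked? step? exponents)

records-increasing : Increasing Close records
records-increasing = Linked.map⁺ {f = value primes} (Linked.map (λ {as} {bs} → step⇒close {as} {bs}) exponents-linked)

records-positive : ∀ {h} → h ∈ records → 1 ≤ h
records-positive = All.lookup (from-yes (all? (1 ≤?_) records))

records≤H : ∀ {h} → h ∈ records → h ≤ H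
records≤H = All.lookup (from-yes (all? (_≤? H) records))

H∈records : H ∈ records
H∈records = from-yes (any? (H ≟_) records)

-- `2 ^ 36` is the least power of two that is at least `H′`.
open Table H′ 36 (from-yes (H′ ≤? 2 ^ 36))

point : List ℕ → Point
point as = value primes as , divisorCount primes as

-- The finite check behind completeness of the list; 21 steps lead from 2 to the base 23.
table-covered : All (λ x → Any (λ as → point as ⊒ x) exponents) (table 2 21)
table-covered = from-yes (all? (λ x → any? (λ as → point as ⊒? x) exponents) (table 2 21))

-- The two dominations compose. With `rs` and `T` variables, the concrete table is not evaluated
-- here.
covers⇒record : ∀ {rs T m} → All (λ x → Any (λ as → point as ⊒ x) rs) T → Covers T (m , d m) →
                ∃ λ h → h ∈ map (value primes) rs × h ≤ m × d m ≤ d h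
covers⇒record {rs} {T} {m} covered c with find c
... | x , x∈ , x⊒m = find (Any.map⁺ (Any.map (λ {as} → dominate {as}) (All.lookup covered x∈)))
  where
  dominate : ∀ {as} → point as ⊒ x → value primes as ≤ m × d m ≤ d (value primes as)
  dominate {as} as⊒x rewrite d≡ as = ⊒-trans {point as} {x} {m , d m} as⊒x x⊒m

records-cover : ∀ m → 1 ≤ m → m < H′ → ∃ λ h → h ∈ records × h ≤ m × d m ≤ d h
records-cover m 1≤m m<H′ =
  -- Every number is 2-rough, so the table for 2 covers all positive `m` below `H′`.
  covers⇒record {exponents} {table 2 21} table-covered (table-covers 21 2 m {{_}} {{>-nonZero 1≤m}} 2-rough m<H′)

-- The values at `H` and `H′`, and the conclusion.

exponentsH exponentsH′ : List ℕ
exponentsH  = 5 ∷ 3 ∷ 2 ∷ 2 ∷ 1 ∷ 1 ∷ 1 ∷ 1 ∷ []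
exponentsH′ = 6 ∷ 3 ∷ 1 ∷ 1 ∷ 1 ∷ 1 ∷ 1 ∷ 1 ∷ 1 ∷ []

-- Stated for a variable n so that d is never unfolded at a number of the size of H.
d-factored : ∀ n as → n ≡ value primes as → d n ≡ divisorCount primes as
d-factored _ as refl = d≡ as

d[H]≡3456 : d H ≡ 3456
d[H]≡3456 = d-factored H exponentsH refl

d[H′]≡3584 : d H′ ≡ 3584
d[H′]≡3584 = d-factored H′ exponentsH′ refl

d[gcd]≡1536 : d (gcd H H′) ≡ 1536
d[gcd]≡1536 = d-factored (gcd H H′) (zipWith _⊓_ exponentsH exponentsH′)
                         (gcd-value exponentsH exponentsH′ primes-prime primes-unique)

d[H]<d[H′] : d H < d H′
d[H]<d[H′] = subst₂ _<_ (sym d[H]≡3456) (sym d[H′]≡3584) (from-yes (3456 <? 3584))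

open Records records H H′ records-positive records-increasing H∈records records≤H
  (from-yes (H <? H′)) d[H]<d[H′] records-cover

-- Swaps the divisor counts for literals, so that the fraction normalises by computation; the proof
-- that the denominator is non-zero is irrelevant and does not obstruct this.
d-ratio-eval : ∀ m n {a b} .{{_ : NonZero n}} .{{_ : NonZero b}} → d m ≡ a → d n ≡ b → d-ratio m n ≡ + a / b
d-ratio-eval m n refl refl = refl

ratio : d-ratio (gcd H H′) H ≡ + 4 / 9
ratio = d-ratio-eval (gcd H H′) H {1536} {3456} d[gcd]≡1536 d[H]≡3456

proposition3p1 : (H ≡ 2 ^ 5 * 3 ^ 3 * 5 ^ 2 * 7 ^ 2 * 11 * 13 * 17 * 19)
    × (H′ ≡ 2 ^ 6 * 3 ^ 3 * 5 * 7 * 11 * 13 * 17 * 19 * 23)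
    × ConsecutiveHC H H′
    × (d H ≡ 3456)
    × (d H′ ≡ 3584)
    × (d (gcd H H′) ≡ 1536)
    × (d-ratio (gcd H H′) H ≡ + 4 / 9)
    × (+ 4 / 9 ℚ.< ½)
    × ((K K′ : ℕ) → ConsecutiveHC K K′ → K < H →
    ½ ℚ.* (+ d K / 1) ℚ.≤ + d (gcd K K′) / 1)
proposition3p1 =
  refl , refl , top-B-consecutive , d[H]≡3456 , d[H′]≡3584 , d[gcd]≡1536 , ratio ,
  from-yes (+ 4 / 9 ℚ.<? ½) ,
  λ K K′ c K<H → ½*-≤ (d K) (d (gcd K K′)) (proj₂ (consecutive⇒close c K<H))
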